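{- For every constant $c>0$, there exists a full-compatibility instance of the online allocation model with a common nonnegative, nondecreasing, discrete-concave bonus function $f$ (i.e. $f_i=f$ for all products $i$) such that $$\mathbb E[\mathrm{Rev}^{\mathrm{Greedy}}]<c\,\mathrm{OPT}_{\mathrm{on}}.$$ The claim holds even when the realized number of arrivals is deterministic.
   Context: Model. An instance consists of products $\mathcal I=\{1,\dots,m\}$, capacities $b_i\in\mathbb Z_+$, base rewards $r_i\ge 0$, bonus functions $f_i:\mathbb Z_+\to\mathbb R_+$ that are nonnegative and nondecreasing with $f_i(0)=0$, a horizon of $T$ periods and arrival probabilities $p_1,\dots,p_T\in[0,1]$. In period $t$ a customer arrives with probability $p_t$, independently across periods. Each arriving customer must be immediately and irrevocably assigned to a product with remaining capacity or rejected; every customer may be assigned to every product (full compatibility). The $k$-th sale of product $i$ yields reward $r_i+f_i(k)$. An online algorithm $\pi$ knows all parameters of the instance, but its decision in each period depends only on the arrivals observed so far, its past decisions and internal randomization independent of the arrivals. $\mathrm{Rev}^\pi$ is its random total reward and $\mathrm{OPT}_{\mathrm{on}}=\sup_\pi\mathbb E[\mathrm{Rev}^\pi]$ over all online algorithms. Discrete concavity of $f$: $f(k+1)-f(k)\le f(k)-f(k-1)$ for all $k\ge1$ in the relevant range (up to capacity). Myopic greedy: given current allocation $\boldsymbol x$, assign an arriving customer to some $i\in\arg\max_{j:\,x_j<b_j}\{r_j+f_j(x_j+1)\}$; if all products are sold out, reject the customer. -}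

module Defs where

open import Algebra.Bundles.Raw using (RawMonoid)
import Algebra.Definitions.RawMonoid as RawMonoidDefinitions
open import Data.Fin.Base using (Fin)
open import Data.Fin.Properties using () renaming (_≟_ to _≟ᶠ_)
open import Data.List.Base using (List; []; _∷_)
open import Data.Nat.Base as ℕ using (ℕ; zero; suc)
import Data.Nat.Properties as ℕₚ
open import Data.Product.Base using (_×_; _,_; ∃-syntax; Σ-syntax)
open import Data.Rational.Base as ℚ using (ℚ; 0ℚ; 1ℚ; ½)
import Data.Rational.Properties as ℚₚ
open import Data.Rational.Solver using (module +-*-Solver)
open import Data.Vec.Functional using (Vector; head; tail)
open import Function.Base using (_∘_)
open import Relation.Binary.PropositionalEquality
open import Relation.Nullary using (¬_; yes; no)

-- Real numbers: Cauchy sequences of rationals, compared up to _≈_.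

IsCauchy : (ℕ → ℚ) → Set
IsCauchy x = ∀ ε → 0ℚ ℚ.< ε →
  ∃[ N ] (∀ m n → N ℕ.≤ m → N ℕ.≤ n → ℚ.∣ x m ℚ.- x n ∣ ℚ.< ε)

record ℝ : Set where
  constructor mkℝ
  field
    seq    : ℕ → ℚ
    cauchy : IsCauchy seq

open ℝ public

infix 4 _≈_ _<_ _≤_

_≈_ : ℝ → ℝ → Set
x ≈ y = ∀ ε → 0ℚ ℚ.< ε → ∃[ N ] (∀ n → N ℕ.≤ n → ℚ.∣ seq x n ℚ.- seq y n ∣ ℚ.< ε)

_<_ : ℝ → ℝ → Set
x < y = ∃[ ε ] (0ℚ ℚ.< ε × ∃[ N ] (∀ n → N ℕ.≤ n → seq x n ℚ.+ ε ℚ.< seq y n))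

_≤_ : ℝ → ℝ → Set
x ≤ y = ¬ (y < x)

private
  half-pos : ∀ {ε} → 0ℚ ℚ.< ε → 0ℚ ℚ.< ½ ℚ.* ε
  half-pos 0<ε = ℚₚ.*-monoʳ-<-pos ½ 0<ε

  halves : ∀ ε → ½ ℚ.* ε ℚ.+ ½ ℚ.* ε ≡ ε
  halves ε = trans (sym (ℚₚ.*-distribʳ-+ ε ½ ½)) (ℚₚ.*-identityˡ ε)

  abstract
    +-cauchy : ∀ x y → IsCauchy x → IsCauchy y → IsCauchy (λ n → x n ℚ.+ y n)
    +-cauchy x y cx cy ε 0<ε with cx (½ ℚ.* ε) (half-pos 0<ε) | cy (½ ℚ.* ε) (half-pos 0<ε)
    ... | M , px | N , py = M ℕ.⊔ N , λ m n lm ln → begin-strict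
      ℚ.∣ (x m ℚ.+ y m) ℚ.- (x n ℚ.+ y n) ∣          ≡⟨ cong ℚ.∣_∣ (regroup (x m) (y m) (x n) (y n)) ⟩
      ℚ.∣ (x m ℚ.- x n) ℚ.+ (y m ℚ.- y n) ∣          ≤⟨ ℚₚ.∣p+q∣≤∣p∣+∣q∣ (x m ℚ.- x n) (y m ℚ.- y n) ⟩
      ℚ.∣ x m ℚ.- x n ∣ ℚ.+ ℚ.∣ y m ℚ.- y n ∣
        <⟨ ℚₚ.+-mono-< (px m n (ℕₚ.m⊔n≤o⇒m≤o M N lm) (ℕₚ.m⊔n≤o⇒m≤o M N ln))
                       (py m n (ℕₚ.m⊔n≤o⇒n≤o M N lm) (ℕₚ.m⊔n≤o⇒n≤o M N ln)) ⟩
      ½ ℚ.* ε ℚ.+ ½ ℚ.* ε                            ≡⟨ halves ε ⟩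
      ε                                              ∎
      where
      open ℚₚ.≤-Reasoning
      open +-*-Solver
      regroup : ∀ a b c d → (a ℚ.+ b) ℚ.- (c ℚ.+ d) ≡ (a ℚ.- c) ℚ.+ (b ℚ.- d)
      regroup = solve 4 (λ a b c d → (a :+ b) :- (c :+ d) := (a :- c) :+ (b :- d)) refl

  abstract
    neg-cauchy : ∀ x → IsCauchy x → IsCauchy (λ n → ℚ.- x n)
    neg-cauchy x cx ε 0<ε with cx ε 0<ε
    ... | N , px = N , λ m n lm ln → subst (ℚ._< ε)
      (trans (sym (ℚₚ.∣-p∣≡∣p∣ (x m ℚ.- x n)))
             (cong ℚ.∣_∣ (ℚₚ.neg-distrib-+ (x m) (ℚ.- x n))))
      (px m n lm ln)

  eventually-bounded : ∀ {x} → IsCauchy x →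
    ∃[ B ] (0ℚ ℚ.< B × ∃[ N ] (∀ n → N ℕ.≤ n → ℚ.∣ x n ∣ ℚ.< B))
  eventually-bounded {x} cx with cx 1ℚ (ℚₚ.positive⁻¹ 1ℚ)
  ... | N , px = ℚ.∣ x N ∣ ℚ.+ 1ℚ
               , ℚₚ.+-mono-≤-< (ℚₚ.0≤∣p∣ (x N)) (ℚₚ.positive⁻¹ 1ℚ)
               , N , λ n ln → begin-strict
    ℚ.∣ x n ∣                            ≡⟨ cong ℚ.∣_∣ (split (x n) (x N)) ⟩
    ℚ.∣ x N ℚ.+ (x n ℚ.- x N) ∣          ≤⟨ ℚₚ.∣p+q∣≤∣p∣+∣q∣ (x N) (x n ℚ.- x N) ⟩
    ℚ.∣ x N ∣ ℚ.+ ℚ.∣ x n ℚ.- x N ∣      <⟨ ℚₚ.+-monoʳ-< ℚ.∣ x N ∣ (px n N ln ℕₚ.≤-refl) ⟩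
    ℚ.∣ x N ∣ ℚ.+ 1ℚ                     ∎
    where
    open ℚₚ.≤-Reasoning
    open +-*-Solver
    split : ∀ a b → a ≡ b ℚ.+ (a ℚ.- b)
    split = solve 2 (λ a b → a := b :+ (a :- b)) refl

  divide : ∀ ε B → 0ℚ ℚ.< ε → 0ℚ ℚ.< B → ∃[ δ ] (0ℚ ℚ.< δ × B ℚ.* δ ≡ ε)
  divide ε B 0<ε 0<B = 1/B ℚ.* ε , 0<1/B*ε , (begin
    B ℚ.* (1/B ℚ.* ε)   ≡⟨ ℚₚ.*-assoc B 1/B ε ⟨
    (B ℚ.* 1/B) ℚ.* ε   ≡⟨ cong (ℚ._* ε) (ℚₚ.*-inverseʳ B) ⟩
    1ℚ ℚ.* ε            ≡⟨ ℚₚ.*-identityˡ ε ⟩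
    ε                   ∎)
    where
    open ≡-Reasoning
    instance
      _ = ℚ.positive 0<B
      _ = ℚ.positive 0<ε
      _ = ℚₚ.pos⇒nonZero B
    1/B : ℚ
    1/B = ℚ.1/ B
    0<1/B*ε : 0ℚ ℚ.< 1/B ℚ.* ε
    0<1/B*ε = ℚₚ.positive⁻¹ (1/B ℚ.* ε)
      {{ℚₚ.pos*pos⇒pos 1/B {{ℚₚ.1/pos⇒pos B}} ε}}

  ∣∣-product-< : ∀ {B δ} p q → 0ℚ ℚ.< B → ℚ.∣ p ∣ ℚ.< B → ℚ.∣ q ∣ ℚ.< δ →
    ℚ.∣ p ℚ.* q ∣ ℚ.< B ℚ.* δ
  ∣∣-product-< {B} {δ} p q 0<B p<B q<δ = begin-strict
    ℚ.∣ p ℚ.* q ∣          ≡⟨ ℚₚ.∣p*q∣≡∣p∣*∣q∣ p q ⟩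
    ℚ.∣ p ∣ ℚ.* ℚ.∣ q ∣    ≤⟨ ℚₚ.*-monoʳ-≤-nonNeg ℚ.∣ q ∣ {{ℚₚ.∣-∣-nonNeg q}} (ℚₚ.<⇒≤ p<B) ⟩
    B ℚ.* ℚ.∣ q ∣          <⟨ ℚₚ.*-monoʳ-<-pos B {{ℚ.positive 0<B}} q<δ ⟩
    B ℚ.* δ                ∎
    where open ℚₚ.≤-Reasoning

  products-close : ∀ {ε B C δ η} a b c d → 0ℚ ℚ.< B → 0ℚ ℚ.< C →
    B ℚ.* δ ≡ ½ ℚ.* ε → C ℚ.* η ≡ ½ ℚ.* ε →
    ℚ.∣ a ∣ ℚ.< B → ℚ.∣ d ∣ ℚ.< C → ℚ.∣ a ℚ.- c ∣ ℚ.< η → ℚ.∣ b ℚ.- d ∣ ℚ.< δ →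
    ℚ.∣ a ℚ.* b ℚ.- c ℚ.* d ∣ ℚ.< ε
  products-close {ε} {B} {C} {δ} {η} a b c d 0<B 0<C Bδ Cη a<B d<C a-c<η b-d<δ = begin-strict
    ℚ.∣ a ℚ.* b ℚ.- c ℚ.* d ∣
      ≡⟨ cong ℚ.∣_∣ (telescope a b c d) ⟩
    ℚ.∣ a ℚ.* (b ℚ.- d) ℚ.+ d ℚ.* (a ℚ.- c) ∣
      ≤⟨ ℚₚ.∣p+q∣≤∣p∣+∣q∣ (a ℚ.* (b ℚ.- d)) (d ℚ.* (a ℚ.- c)) ⟩
    ℚ.∣ a ℚ.* (b ℚ.- d) ∣ ℚ.+ ℚ.∣ d ℚ.* (a ℚ.- c) ∣
      <⟨ ℚₚ.+-mono-< (∣∣-product-< a (b ℚ.- d) 0<B a<B b-d<δ)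
                     (∣∣-product-< d (a ℚ.- c) 0<C d<C a-c<η) ⟩
    B ℚ.* δ ℚ.+ C ℚ.* η      ≡⟨ cong₂ ℚ._+_ Bδ Cη ⟩
    ½ ℚ.* ε ℚ.+ ½ ℚ.* ε      ≡⟨ halves ε ⟩
    ε                        ∎
    where
    open ℚₚ.≤-Reasoning
    open +-*-Solver
    telescope : ∀ a b c d →
      a ℚ.* b ℚ.- c ℚ.* d ≡ a ℚ.* (b ℚ.- d) ℚ.+ d ℚ.* (a ℚ.- c)
    telescope = solve 4 (λ a b c d →
      a :* b :- c :* d := a :* (b :- d) :+ d :* (a :- c)) refl

  abstract
    *-cauchy : ∀ x y → IsCauchy x → IsCauchy y → IsCauchy (λ n → x n ℚ.* y n)
    *-cauchy x y cx cy ε 0<ε =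
      let
        B , 0<B , K , bx = eventually-bounded cx
        C , 0<C , L , by = eventually-bounded cy
        δ , 0<δ , Bδ     = divide (½ ℚ.* ε) B (half-pos 0<ε) 0<B
        η , 0<η , Cη     = divide (½ ℚ.* ε) C (half-pos 0<ε) 0<C
        M , px           = cx η 0<η
        N , py           = cy δ 0<δ
      in (K ℕ.⊔ L) ℕ.⊔ (M ℕ.⊔ N) , λ m n lm ln →
      let
        KL≤m = ℕₚ.m⊔n≤o⇒m≤o (K ℕ.⊔ L) (M ℕ.⊔ N) lm
        KL≤n = ℕₚ.m⊔n≤o⇒m≤o (K ℕ.⊔ L) (M ℕ.⊔ N) ln
        MN≤m = ℕₚ.m⊔n≤o⇒n≤o (K ℕ.⊔ L) (M ℕ.⊔ N) lm
        MN≤n = ℕₚ.m⊔n≤o⇒n≤o (K ℕ.⊔ L) (M ℕ.⊔ N) ln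
      in products-close {ε} {B} {C} {δ} {η} (x m) (y m) (x n) (y n) 0<B 0<C Bδ Cη
        (bx m (ℕₚ.m⊔n≤o⇒m≤o K L KL≤m))
        (by n (ℕₚ.m⊔n≤o⇒n≤o K L KL≤n))
        (px m n (ℕₚ.m⊔n≤o⇒m≤o M N MN≤m) (ℕₚ.m⊔n≤o⇒m≤o M N MN≤n))
        (py m n (ℕₚ.m⊔n≤o⇒n≤o M N MN≤m) (ℕₚ.m⊔n≤o⇒n≤o M N MN≤n))

fromℚ : ℚ → ℝ
fromℚ q = mkℝ (λ _ → q) (λ ε 0<ε → 0 , λ _ _ _ _ →
  subst (ℚ._< ε) (sym (cong ℚ.∣_∣ (ℚₚ.+-inverseʳ q))) 0<ε)

0ℝ 1ℝ : ℝ
0ℝ = fromℚ 0ℚ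
1ℝ = fromℚ 1ℚ

infixl 7 _*_
infixl 6 _+_ _-_

_+_ _*_ _-_ : ℝ → ℝ → ℝ
x + y = mkℝ (λ n → seq x n ℚ.+ seq y n) (+-cauchy (seq x) (seq y) (cauchy x) (cauchy y))
x * y = mkℝ (λ n → seq x n ℚ.* seq y n) (*-cauchy (seq x) (seq y) (cauchy x) (cauchy y))
x - y = mkℝ (λ n → seq x n ℚ.- seq y n)
  (+-cauchy (seq x) (λ n → ℚ.- seq y n) (cauchy x) (neg-cauchy (seq y) (cauchy y)))

+-rawMonoid : RawMonoid _ _
+-rawMonoid = record { Carrier = ℝ ; _≈_ = _≈_ ; _∙_ = _+_ ; ε = 0ℝ }

open RawMonoidDefinitions +-rawMonoid public using (sum)

-- The constructive reading of "s = sup X": an upper bound which elements of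
-- the family approximate arbitrarily well.
IsSupremum : {A : Set} → (A → ℝ) → ℝ → Set
IsSupremum X s = (∀ a → X a ≤ s) × (∀ y → y < s → ∃[ a ] y < X a)

record IsBonus (f : ℕ → ℝ) : Set where
  field
    vanishes-at-0 : f 0 ≈ 0ℝ
    nonNegative   : ∀ k → 0ℝ ≤ f k
    nondecreasing : ∀ {k l} → k ℕ.≤ l → f k ≤ f l

-- Full compatibility is built in: there is no compatibility relation between
-- customers and products.  Products are indexed from 0.
record Instance : Set where
  field
    m        : ℕ
    capacity : Fin m → ℕ
    reward   : Fin m → ℝ
    bonus    : Fin m → ℕ → ℝ
    T        : ℕ
    arrival  : Vector ℝ T

    reward-nonNeg : ∀ i → 0ℝ ≤ reward i
    bonus-isBonus : ∀ i → IsBonus (bonus i)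
    arrival-prob  : ∀ t → 0ℝ ≤ arrival t × arrival t ≤ 1ℝ

-- f (k + 1) - f k ≤ f k - f (k - 1) for 1 ≤ k < b, with k shifted by one.
DiscreteConcaveUpTo : ℕ → (ℕ → ℝ) → Set
DiscreteConcaveUpTo b f =
  ∀ k → suc (suc k) ℕ.≤ b → f (suc (suc k)) - f (suc k) ≤ f (suc k) - f k

HasCommonConcaveBonus : Instance → Set
HasCommonConcaveBonus I = Σ[ f ∈ (ℕ → ℝ) ]
  ( IsBonus f
  × (∀ i → DiscreteConcaveUpTo (capacity i) f)
  × (∀ i k → bonus i k ≈ f k))
  where open Instance I

-- Probability that exactly n customers arrive, for independent arrivals.
arrivalCountProb : ∀ {T} → Vector ℝ T → ℕ → ℝ
arrivalCountProb {zero}  p zero    = 1ℝ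
arrivalCountProb {zero}  p (suc n) = 0ℝ
arrivalCountProb {suc T} p zero    = (1ℝ - head p) * arrivalCountProb (tail p) zero
arrivalCountProb {suc T} p (suc n) =
  (1ℝ - head p) * arrivalCountProb (tail p) (suc n) + head p * arrivalCountProb (tail p) n

HasDeterministicArrivalCount : Instance → Set
HasDeterministicArrivalCount I = ∃[ n ] arrivalCountProb (Instance.arrival I) n ≈ 1ℝ

data Decision (m : ℕ) : Set where
  reject : Decision m
  assign : Fin m → Decision m

data Event (m : ℕ) : Set where
  noArrival : Event m
  arrived   : Decision m → Event m

-- What has been observed and decided so far, most recent period first; its
-- length is the number of elapsed periods.
History : ℕ → Set
History m = List (Event m)

sumDecisions : ∀ {m} → (Decision m → ℝ) → ℝ
sumDecisions g = g reject + sum (g ∘ assign)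

sold : ∀ {m} → History m → Fin m → ℕ
sold []                          i = 0
sold (noArrival          ∷ h) i = sold h i
sold (arrived reject     ∷ h) i = sold h i
sold (arrived (assign j) ∷ h) i with j ≟ᶠ i
... | yes _ = suc (sold h i)
... | no  _ = sold h i

module _ (I : Instance) where
  open Instance I

  Available : History m → Fin m → Set
  Available h i = sold h i ℕ.< capacity i

  -- prob h d is the conditional probability, over the internal randomization,
  -- that a customer arriving after history h receives decision d.
  record OnlineAlgorithm : Set where
    field
      prob        : History m → Decision m → ℝ
      prob-nonNeg : ∀ h d → 0ℝ ≤ prob h d
      prob-sum    : ∀ h → sumDecisions (prob h) ≈ 1ℝ
      feasible    : ∀ h i → ¬ Available h i → prob h (assign i) ≈ 0ℝ

  open OnlineAlgorithm

  nextReward : History m → Fin m → ℝ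
  nextReward h i = reward i + bonus i (suc (sold h i))

  Rev : History m → ℝ
  Rev []                       = 0ℝ
  Rev (noArrival          ∷ h) = Rev h
  Rev (arrived reject     ∷ h) = Rev h
  Rev (arrived (assign i) ∷ h) = Rev h + nextReward h i

  -- Expectation of X over the history at the end of the horizon, given the
  -- current history h and the arrival probabilities p of the remaining periods.
  expectation : OnlineAlgorithm → (History m → ℝ) → ∀ {n} → Vector ℝ n → History m → ℝ
  expectation π X {zero}  p h = X h
  expectation π X {suc n} p h =
    (1ℝ - head p) * expectation π X (tail p) (noArrival ∷ h)
    + head p * sumDecisions (λ d → prob π h d * expectation π X (tail p) (arrived d ∷ h))

  𝔼Rev : OnlineAlgorithm → ℝ
  𝔼Rev π = expectation π Rev arrival []

  IsOPTon : ℝ → Set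
  IsOPTon = IsSupremum 𝔼Rev

  IsGreedyDecision : History m → Decision m → Set
  IsGreedyDecision h reject     = ∀ j → ¬ Available h j
  IsGreedyDecision h (assign i) =
    Available h i × (∀ j → Available h j → nextReward h j ≤ nextReward h i)

  -- Ties may be broken in any way, possibly at random.
  IsMyopicGreedy : OnlineAlgorithm → Set
  IsMyopicGreedy π = ∀ h d → 0ℝ < prob π h d → IsGreedyDecision h d

-- Let f(k) = k.  One product of base reward 0 and capacity T competes with T
-- traps of base reward 1 and capacity 1, and T customers arrive surely.  As
-- long as product 0 is unsold it pays 1 while a trap pays 2, so greedy only
-- sells traps and earns 2T.  Always selling product 0 earns 1 + 2 + ... + T,
-- which is optimal for T ≥ 3.  All rewards being integers, the only genuine
-- reals are the constant c and the probabilities of an algorithm.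

module Submission where

open import Defs
open import Algebra.Bundles using (CommutativeRing)
import Algebra.Properties.Monoid.Mult as MonoidMult
import Algebra.Properties.Semiring.Mult as SemiringMult
open import Data.Fin.Base using (Fin; zero; suc)
open import Data.Fin.Properties using (any?; pigeonhole) renaming (_≟_ to _≟ᶠ_)
open import Data.Integer.Base as ℤ using (+_; +[1+_])
import Data.Integer.Properties as ℤₚ
open import Data.List.Base using ([]; _∷_; length; lookup)
open import Data.Nat.Base as ℕ using (ℕ; zero; suc)
import Data.Nat.Properties as ℕₚ
import Data.Nat.Solver as ℕ-Solver
open import Data.Product.Base using (_×_; _,_; ∃-syntax; Σ-syntax; proj₁; proj₂)
open import Data.Rational.Base as ℚ using (ℚ; 0ℚ; 1ℚ; ½; mkℚ)
import Data.Rational.Properties as ℚₚ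
import Data.Rational.Solver as ℚ-Solver
import Data.Rational.Unnormalised.Base as ℚᵘ
import Data.Rational.Unnormalised.Properties as ℚᵘₚ
open import Data.Sum.Base using (_⊎_; inj₁; inj₂)
open import Function.Base using (_∘_)
open import Relation.Binary.Definitions using (DecidableEquality)
open import Relation.Binary.PropositionalEquality
open import Relation.Nullary using (¬_; Dec; yes; no; contradiction)

open SemiringMult (CommutativeRing.semiring ℚₚ.+-*-commutativeRing)
  using (×1-homo-*) renaming (_×_ to _×ℚ_)
open MonoidMult ℚₚ.+-0-monoid using (×-homo-+)
open OnlineAlgorithm

-- Natural numbers and elementary inequalities in the rationals.

ι : ℕ → ℚ
ι n = n ×ℚ 1ℚ

ι-+ : ∀ a b → ι (a ℕ.+ b) ≡ ι a ℚ.+ ι b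
ι-+ = ×-homo-+ 1ℚ

ι-* : ∀ a b → ι (a ℕ.* b) ≡ ι a ℚ.* ι b
ι-* = ×1-homo-*

0≤1ℚ : 0ℚ ℚ.≤ 1ℚ
0≤1ℚ = ℚₚ.nonNegative⁻¹ 1ℚ

0<1ℚ : 0ℚ ℚ.< 1ℚ
0<1ℚ = ℚₚ.positive⁻¹ 1ℚ

0≤ι : ∀ n → 0ℚ ℚ.≤ ι n
0≤ι zero    = ℚₚ.≤-refl
0≤ι (suc n) = ℚₚ.+-mono-≤ 0≤1ℚ (0≤ι n)

ι-mono-≤ : ∀ {a b} → a ℕ.≤ b → ι a ℚ.≤ ι b
ι-mono-≤ {b = b} ℕ.z≤n = 0≤ι b
ι-mono-≤ (ℕ.s≤s a≤b)   = ℚₚ.+-monoʳ-≤ 1ℚ (ι-mono-≤ a≤b)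

ι-mono-< : ∀ {a b} → a ℕ.< b → ι a ℚ.< ι b
ι-mono-< {a} a<b = ℚₚ.<-≤-trans
  (subst (ℚ._< 1ℚ ℚ.+ ι a) (ℚₚ.+-identityˡ (ι a)) (ℚₚ.+-monoˡ-< (ι a) 0<1ℚ))
  (ι-mono-≤ a<b)

-- `ι` is built by repeated addition. Its form as a fraction with denominator 1 lets `archimedean`
-- compare by cross-multiplication.
toℚᵘ-ι : ∀ n → ℚ.toℚᵘ (ι n) ℚᵘ.≃ ℚᵘ.mkℚᵘ (+ n) 0
toℚᵘ-ι zero    = ℚᵘ.*≡* refl
toℚᵘ-ι (suc n) = ℚᵘₚ.≃-trans (ℚₚ.toℚᵘ-homo-+ 1ℚ (ι n))
  (ℚᵘₚ.≃-trans (ℚᵘₚ.+-congʳ ℚᵘ.1ℚᵘ (toℚᵘ-ι n))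
    (ℚᵘ.*≡* (cong (λ k → (+ 1 ℤ.+ k) ℤ.* + 1) (ℤₚ.*-identityʳ (+ n)))))

archimedean : ∀ {ε} → 0ℚ ℚ.< ε → ∃[ q ] 1ℚ ℚ.≤ ε ℚ.* ι q
-- The witness is the denominator of `ε`: the product is then its numerator, a positive integer.
archimedean {ε@(mkℚ +[1+ k ] d _)} _ = suc d , ℚₚ.toℚᵘ-cancel-≤
  (ℚᵘₚ.≤-respʳ-≃
    (ℚᵘₚ.≃-sym (ℚᵘₚ.≃-trans (ℚₚ.toℚᵘ-homo-* ε (ι (suc d)))
                             (ℚᵘₚ.*-congˡ {ℚ.toℚᵘ ε} (toℚᵘ-ι (suc d)))))
    (ℚᵘ.*≤* (ℤ.+≤+ denominator-bound)))
  where
  open ℕₚ.≤-Reasoning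
  denominator-bound : 1 ℕ.* (suc d ℕ.* 1) ℕ.≤ (suc k ℕ.* suc d) ℕ.* 1
  denominator-bound = begin
    1 ℕ.* (suc d ℕ.* 1)       ≡⟨ trans (ℕₚ.*-identityˡ _) (ℕₚ.*-identityʳ (suc d)) ⟩
    suc d                     ≤⟨ ℕₚ.m≤m+n (suc d) (k ℕ.* suc d) ⟩
    suc k ℕ.* suc d           ≡⟨ ℕₚ.*-identityʳ _ ⟨
    (suc k ℕ.* suc d) ℕ.* 1   ∎
archimedean {mkℚ (+ 0) d _} (ℚ.*<* (ℤ.+<+ ()))
archimedean {mkℚ ℤ.-[1+ k ] d _} (ℚ.*<* ())

p≤∣p∣ : ∀ p → p ℚ.≤ ℚ.∣ p ∣
p≤∣p∣ p with ℚₚ.≤-total 0ℚ p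
... | inj₁ 0≤p = ℚₚ.≤-reflexive (sym (ℚₚ.0≤p⇒∣p∣≡p 0≤p))
... | inj₂ p≤0 = ℚₚ.≤-trans p≤0 (ℚₚ.0≤∣p∣ p)

∣p∣≤q : ∀ {p q} → p ℚ.≤ q → ℚ.- p ℚ.≤ q → ℚ.∣ p ∣ ℚ.≤ q
∣p∣≤q {p} {q} p≤q -p≤q with ℚₚ.∣p∣≡p∨∣p∣≡-p p
... | inj₁ ∣p∣≡p  = subst (ℚ._≤ q) (sym ∣p∣≡p) p≤q
... | inj₂ ∣p∣≡-p = subst (ℚ._≤ q) (sym ∣p∣≡-p) -p≤q

p≡q+[p-q] : ∀ p q → p ≡ q ℚ.+ (p ℚ.- q)
p≡q+[p-q] = solve 2 (λ p q → p := q :+ (p :- q)) refl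
  where open ℚ-Solver.+-*-Solver

≤-difference : ∀ a b → a ℚ.≤ b ℚ.+ ℚ.∣ a ℚ.- b ∣
≤-difference a b = begin
  a                        ≡⟨ p≡q+[p-q] a b ⟩
  b ℚ.+ (a ℚ.- b)          ≤⟨ ℚₚ.+-monoʳ-≤ b (p≤∣p∣ (a ℚ.- b)) ⟩
  b ℚ.+ ℚ.∣ a ℚ.- b ∣      ∎
  where open ℚₚ.≤-Reasoning

≤-shift : ∀ {a b ε} → a ℚ.≤ b ℚ.+ ε → a ℚ.- b ℚ.≤ ε
≤-shift {a} {b} {ε} a≤b+ε = begin
  a ℚ.- b              ≤⟨ ℚₚ.+-monoˡ-≤ (ℚ.- b) a≤b+ε ⟩
  (b ℚ.+ ε) ℚ.- b      ≡⟨ cancel b ε ⟩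
  ε                    ∎
  where
  open ℚₚ.≤-Reasoning
  open ℚ-Solver.+-*-Solver
  cancel : ∀ p q → (p ℚ.+ q) ℚ.- p ≡ q
  cancel = solve 2 (λ p q → (p :+ q) :- p := q) refl

≤-unshift : ∀ {a b ε} → a ℚ.- b ℚ.≤ ε → a ℚ.≤ b ℚ.+ ε
≤-unshift {a} {b} {ε} a-b≤ε = begin
  a                    ≡⟨ p≡q+[p-q] a b ⟩
  b ℚ.+ (a ℚ.- b)      ≤⟨ ℚₚ.+-monoʳ-≤ b a-b≤ε ⟩
  b ℚ.+ ε              ∎
  where open ℚₚ.≤-Reasoning

abstract
  quotient : ∀ {ε B} → 0ℚ ℚ.< ε → 0ℚ ℚ.< B → ∃[ δ ] (0ℚ ℚ.< δ × B ℚ.* δ ≡ ε)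
  quotient {ε} {B} 0<ε 0<B = ℚ.1/ B ℚ.* ε
    , ℚₚ.positive⁻¹ (ℚ.1/ B ℚ.* ε) {{ℚₚ.pos*pos⇒pos (ℚ.1/ B) {{ℚₚ.1/pos⇒pos B}} ε}}
    , (begin
      B ℚ.* (ℚ.1/ B ℚ.* ε)   ≡⟨ ℚₚ.*-assoc B (ℚ.1/ B) ε ⟨
      (B ℚ.* ℚ.1/ B) ℚ.* ε   ≡⟨ cong (ℚ._* ε) (ℚₚ.*-inverseʳ B) ⟩
      1ℚ ℚ.* ε               ≡⟨ ℚₚ.*-identityˡ ε ⟩
      ε                      ∎)
    where
    open ≡-Reasoning
    instance
      B-pos : ℚ.Positive B
      B-pos = ℚ.positive 0<B
      ε-pos : ℚ.Positive ε
      ε-pos = ℚ.positive 0<ε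
      B-nonZero : ℚ.NonZero B
      B-nonZero = ℚₚ.pos⇒nonZero B

  halve : ∀ {ε} → 0ℚ ℚ.< ε → ∃[ δ ] (0ℚ ℚ.< δ × δ ℚ.+ δ ≡ ε)
  halve {ε} 0<ε = ½ ℚ.* ε , ℚₚ.*-monoʳ-<-pos ½ 0<ε
    , trans (sym (ℚₚ.*-distribʳ-+ ε ½ ½)) (ℚₚ.*-identityˡ ε)

-- Eventual comparison of Cauchy sequences.

Eventually : (ℕ → Set) → Set
Eventually P = ∃[ N ] (∀ n → N ℕ.≤ n → P n)

always : ∀ {P : ℕ → Set} → (∀ n → P n) → Eventually P
always p = 0 , λ n _ → p n

eventually-map : ∀ {P Q : ℕ → Set} → (∀ n → P n → Q n) → Eventually P → Eventually Q
eventually-map f (N , p) = N , λ n N≤n → f n (p n N≤n)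

eventually-map₂ : ∀ {P Q R : ℕ → Set} → (∀ n → P n → Q n → R n) →
  Eventually P → Eventually Q → Eventually R
eventually-map₂ f (M , p) (N , q) = M ℕ.⊔ N , λ n M⊔N≤n →
  f n (p n (ℕₚ.m⊔n≤o⇒m≤o M N M⊔N≤n)) (q n (ℕₚ.m⊔n≤o⇒n≤o M N M⊔N≤n))

-- A positive form of x ≤ y, which Defs only states as ¬ (y < x).  It is a
-- record so that x and y can be inferred.
infix 4 _≲_
record _≲_ (x y : ℝ) : Set where
  field approx : ∀ {ε} → 0ℚ ℚ.< ε → Eventually (λ n → seq x n ℚ.≤ seq y n ℚ.+ ε)

open _≲_

-- Since `x - y` is Cauchy, a rational test at one late index settles the tail. With `α = ε/2` and
-- `δ = ε/4`, a value at most `α` keeps the tail at most `ε`, while a larger value keeps it above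
-- `δ`, which would prove `y < x`.
≤⇒≲ : ∀ {x y} → x ≤ y → x ≲ y
≤⇒≲ {x} {y} x≤y .approx {ε} 0<ε with halve 0<ε
... | α , 0<α , α+α≡ε with halve 0<α
... | δ , 0<δ , δ+δ≡α with cauchy (x - y) δ 0<δ
... | N , close with seq (x - y) N ℚₚ.≤? α
... | yes dN≤α = N , λ n N≤n → ≤-unshift (begin
    d n                             ≤⟨ ≤-difference (d n) (d N) ⟩
    d N ℚ.+ ℚ.∣ d n ℚ.- d N ∣       ≤⟨ ℚₚ.+-mono-≤ dN≤α (ℚₚ.<⇒≤ (close n N N≤n ℕₚ.≤-refl)) ⟩
    α ℚ.+ δ                         ≤⟨ ℚₚ.+-monoʳ-≤ α (subst₂ ℚ._≤_ (ℚₚ.+-identityʳ δ) δ+δ≡α (ℚₚ.+-monoʳ-≤ δ (ℚₚ.<⇒≤ 0<δ))) ⟩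
    α ℚ.+ α                         ≡⟨ α+α≡ε ⟩
    ε                               ∎)
  where
  open ℚₚ.≤-Reasoning
  d = seq (x - y)
... | no  dN≰α = contradiction (δ , 0<δ , N , λ n N≤n → begin-strict
    seq y n ℚ.+ δ                   ≡⟨ insert (seq y n) δ ⟩
    (seq y n ℚ.+ (δ ℚ.+ δ)) ℚ.- δ   ≡⟨ cong (λ p → (seq y n ℚ.+ p) ℚ.- δ) δ+δ≡α ⟩
    (seq y n ℚ.+ α) ℚ.- δ           <⟨ ℚₚ.+-monoˡ-< (ℚ.- δ) (ℚₚ.+-monoʳ-< (seq y n) (ℚₚ.≰⇒> dN≰α)) ⟩
    (seq y n ℚ.+ d N) ℚ.- δ         ≤⟨ ℚₚ.+-monoˡ-≤ (ℚ.- δ) (ℚₚ.+-monoʳ-≤ (seq y n)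
                                         (ℚₚ.≤-trans (≤-difference (d N) (d n))
                                           (ℚₚ.+-monoʳ-≤ (d n) (ℚₚ.<⇒≤ (close N n ℕₚ.≤-refl N≤n))))) ⟩
    (seq y n ℚ.+ (d n ℚ.+ δ)) ℚ.- δ ≡⟨ cancel (seq x n) (seq y n) δ ⟩
    seq x n                         ∎) x≤y
  where
  open ℚₚ.≤-Reasoning
  open ℚ-Solver.+-*-Solver
  d = seq (x - y)
  insert : ∀ y δ → y ℚ.+ δ ≡ (y ℚ.+ (δ ℚ.+ δ)) ℚ.- δ
  insert = solve 2 (λ y δ → y :+ δ := (y :+ (δ :+ δ)) :- δ) refl
  cancel : ∀ x y δ → (y ℚ.+ ((x ℚ.- y) ℚ.+ δ)) ℚ.- δ ≡ x
  cancel = solve 3 (λ x y δ → (y :+ ((x :- y) :+ δ)) :- δ := x) refl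

≲⇒≤ : ∀ {x y} → x ≲ y → x ≤ y
≲⇒≤ {x} {y} x≲y (ε , 0<ε , y<x) with eventually-map₂ (λ n a b → ℚₚ.<-≤-trans a b) y<x (approx x≲y 0<ε)
... | N , absurd = ℚₚ.<-irrefl refl (absurd N ℕₚ.≤-refl)

≡⇒≲ : ∀ {x y} → (∀ n → seq x n ≡ seq y n) → x ≲ y
≡⇒≲ {x} {y} x≡y .approx {ε} 0<ε = always λ n → begin
  seq x n          ≡⟨ x≡y n ⟩
  seq y n          ≡⟨ ℚₚ.+-identityʳ (seq y n) ⟨
  seq y n ℚ.+ 0ℚ   ≤⟨ ℚₚ.+-monoʳ-≤ (seq y n) (ℚₚ.<⇒≤ 0<ε) ⟩
  seq y n ℚ.+ ε    ∎
  where open ℚₚ.≤-Reasoning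

≡⇒≈ : ∀ x y → (∀ n → seq x n ≡ seq y n) → x ≈ y
≡⇒≈ x y x≡y ε 0<ε = always λ n →
  subst (ℚ._< ε) (sym (cong ℚ.∣_∣ (trans (cong (ℚ._- seq y n) (x≡y n)) (ℚₚ.+-inverseʳ (seq y n))))) 0<ε

≈⇒≲ : ∀ {x y} → x ≈ y → x ≲ y
≈⇒≲ {x} {y} x≈y .approx {ε} 0<ε = eventually-map
  (λ n close → ℚₚ.≤-trans (≤-difference (seq x n) (seq y n)) (ℚₚ.+-monoʳ-≤ (seq y n) (ℚₚ.<⇒≤ close)))
  (x≈y ε 0<ε)

fromℚ-mono-≤ : ∀ {p q} → p ℚ.≤ q → fromℚ p ≲ fromℚ q
fromℚ-mono-≤ {p} {q} p≤q .approx {ε} 0<ε = always λ _ →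
  subst (ℚ._≤ q ℚ.+ ε) (ℚₚ.+-identityʳ p) (ℚₚ.+-mono-≤ p≤q (ℚₚ.<⇒≤ 0<ε))

≲-trans : ∀ {x y z} → x ≲ y → y ≲ z → x ≲ z
≲-trans {x} {y} {z} x≲y y≲z .approx {ε} 0<ε with halve 0<ε
... | δ , 0<δ , 2δ≡ε = eventually-map₂ (λ n x≤y y≤z → begin
  seq x n                  ≤⟨ x≤y ⟩
  seq y n ℚ.+ δ            ≤⟨ ℚₚ.+-monoˡ-≤ δ y≤z ⟩
  (seq z n ℚ.+ δ) ℚ.+ δ    ≡⟨ ℚₚ.+-assoc (seq z n) δ δ ⟩
  seq z n ℚ.+ (δ ℚ.+ δ)    ≡⟨ cong (seq z n ℚ.+_) 2δ≡ε ⟩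
  seq z n ℚ.+ ε            ∎) (approx x≲y 0<δ) (approx y≲z 0<δ)
  where open ℚₚ.≤-Reasoning

+-mono-≲ : ∀ {w x y z} → w ≲ x → y ≲ z → w + y ≲ x + z
+-mono-≲ {w} {x} {y} {z} w≲x y≲z .approx {ε} 0<ε with halve 0<ε
... | δ , 0<δ , 2δ≡ε = eventually-map₂ (λ n w≤x y≤z → begin
  seq w n ℚ.+ seq y n                    ≤⟨ ℚₚ.+-mono-≤ w≤x y≤z ⟩
  (seq x n ℚ.+ δ) ℚ.+ (seq z n ℚ.+ δ)    ≡⟨ interchange (seq x n) (seq z n) δ ⟩
  (seq x n ℚ.+ seq z n) ℚ.+ (δ ℚ.+ δ)    ≡⟨ cong (seq x n ℚ.+ seq z n ℚ.+_) 2δ≡ε ⟩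
  (seq x n ℚ.+ seq z n) ℚ.+ ε            ∎) (approx w≲x 0<δ) (approx y≲z 0<δ)
  where
  open ℚₚ.≤-Reasoning
  open ℚ-Solver.+-*-Solver
  interchange : ∀ p q r → (p ℚ.+ r) ℚ.+ (q ℚ.+ r) ≡ (p ℚ.+ q) ℚ.+ (r ℚ.+ r)
  interchange = solve 3 (λ p q r → (p :+ r) :+ (q :+ r) := (p :+ q) :+ (r :+ r)) refl

bounded : ∀ x → ∃[ B ] (0ℚ ℚ.< B × Eventually (λ n → ℚ.∣ seq x n ∣ ℚ.≤ B))
bounded x with cauchy x 1ℚ 0<1ℚ
... | N , close = ℚ.∣ seq x N ∣ ℚ.+ 1ℚ
  , ℚₚ.+-mono-≤-< (ℚₚ.0≤∣p∣ (seq x N)) 0<1ℚ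
  , N , λ n N≤n → begin
    ℚ.∣ seq x n ∣                                 ≡⟨ cong ℚ.∣_∣ (p≡q+[p-q] (seq x n) (seq x N)) ⟩
    ℚ.∣ seq x N ℚ.+ (seq x n ℚ.- seq x N) ∣       ≤⟨ ℚₚ.∣p+q∣≤∣p∣+∣q∣ (seq x N) (seq x n ℚ.- seq x N) ⟩
    ℚ.∣ seq x N ∣ ℚ.+ ℚ.∣ seq x n ℚ.- seq x N ∣   ≤⟨ ℚₚ.+-monoʳ-≤ ℚ.∣ seq x N ∣ (ℚₚ.<⇒≤ (close n N N≤n ℕₚ.≤-refl)) ⟩
    ℚ.∣ seq x N ∣ ℚ.+ 1ℚ                          ∎
  where open ℚₚ.≤-Reasoning

∣p∣∣q∣-bound : ∀ {p q a b} → ℚ.∣ p ∣ ℚ.≤ a → ℚ.∣ q ∣ ℚ.≤ b → p ℚ.* q ℚ.≤ a ℚ.* b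
∣p∣∣q∣-bound {p} {q} {a} {b} p≤a q≤b = begin
  p ℚ.* q               ≤⟨ p≤∣p∣ (p ℚ.* q) ⟩
  ℚ.∣ p ℚ.* q ∣         ≡⟨ ℚₚ.∣p*q∣≡∣p∣*∣q∣ p q ⟩
  ℚ.∣ p ∣ ℚ.* ℚ.∣ q ∣   ≤⟨ ℚₚ.*-monoʳ-≤-nonNeg ℚ.∣ q ∣ {{ℚₚ.∣-∣-nonNeg q}} p≤a ⟩
  a ℚ.* ℚ.∣ q ∣         ≤⟨ ℚₚ.*-monoˡ-≤-nonNeg a {{ℚ.nonNegative (ℚₚ.≤-trans (ℚₚ.0≤∣p∣ p) p≤a)}} q≤b ⟩
  a ℚ.* b               ∎
  where open ℚₚ.≤-Reasoning

nonNeg-product-bound : ∀ {p q B δ} → 0ℚ ℚ.≤ p → p ℚ.≤ B → 0ℚ ℚ.≤ δ → q ℚ.≤ δ → p ℚ.* q ℚ.≤ B ℚ.* δ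
nonNeg-product-bound {p} {q} {B} {δ} 0≤p p≤B 0≤δ q≤δ = ℚₚ.≤-trans
  (ℚₚ.*-monoˡ-≤-nonNeg p {{ℚ.nonNegative 0≤p}} q≤δ)
  (ℚₚ.*-monoʳ-≤-nonNeg δ {{ℚ.nonNegative 0≤δ}} p≤B)

-- The alternative among the hypotheses serves expectations: there `x` is a probability, and an
-- outcome of probability zero comes with no bound on its value.
*-monoʳ-≲ : ∀ {x y z} → 0ℝ ≲ x → x ≲ 0ℝ ⊎ y ≲ z → x * y ≲ x * z
*-monoʳ-≲ {x} {y} {z} 0≲x x≲0⊎y≲z .approx {ε} 0<ε = bound x≲0⊎y≲z
  where
  open ℚₚ.≤-Reasoning
  B-bounds = bounded x
  C-bounds = bounded (y - z)
  B = proj₁ B-bounds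
  C = proj₁ C-bounds
  0<B = proj₁ (proj₂ B-bounds)
  0<C = proj₁ (proj₂ C-bounds)
  -- Dividing `ε` by the sum of the two bounds makes both `B * δ` and `δ * C` at most `ε`.
  scale = quotient {ε} {B ℚ.+ C} 0<ε (ℚₚ.+-mono-< 0<B 0<C)
  δ = proj₁ scale
  0<δ = proj₁ (proj₂ scale)
  0≤δ = ℚₚ.<⇒≤ 0<δ

  Bδ≤ε : B ℚ.* δ ℚ.≤ ε
  Bδ≤ε = begin
    B ℚ.* δ            ≤⟨ ℚₚ.*-monoʳ-≤-nonNeg δ {{ℚ.nonNegative 0≤δ}}
                            (subst (ℚ._≤ B ℚ.+ C) (ℚₚ.+-identityʳ B) (ℚₚ.+-monoʳ-≤ B (ℚₚ.<⇒≤ 0<C))) ⟩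
    (B ℚ.+ C) ℚ.* δ    ≡⟨ proj₂ (proj₂ scale) ⟩
    ε                  ∎

  δC≤ε : δ ℚ.* C ℚ.≤ ε
  δC≤ε = begin
    δ ℚ.* C            ≡⟨ ℚₚ.*-comm δ C ⟩
    C ℚ.* δ            ≤⟨ ℚₚ.*-monoʳ-≤-nonNeg δ {{ℚ.nonNegative 0≤δ}}
                            (subst (ℚ._≤ B ℚ.+ C) (ℚₚ.+-identityˡ C) (ℚₚ.+-monoˡ-≤ C (ℚₚ.<⇒≤ 0<B))) ⟩
    (B ℚ.+ C) ℚ.* δ    ≡⟨ proj₂ (proj₂ scale) ⟩
    ε                  ∎

  factor : ∀ n → seq x n ℚ.* (seq y n ℚ.- seq z n) ℚ.≤ ε →
    seq (x * y) n ℚ.≤ seq (x * z) n ℚ.+ ε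
  factor n le = ≤-unshift (subst (ℚ._≤ ε)
    (*-distribˡ-- (seq x n) (seq y n) (seq z n)) le)
    where
    open ℚ-Solver.+-*-Solver
    *-distribˡ-- : ∀ p q r → p ℚ.* (q ℚ.- r) ≡ p ℚ.* q ℚ.- p ℚ.* r
    *-distribˡ-- = solve 3 (λ p q r → p :* (q :- r) := p :* q :- p :* r) refl

  -x≤δ : Eventually (λ n → ℚ.- seq x n ℚ.≤ δ)
  -x≤δ = eventually-map (λ n 0≤x+δ → subst (ℚ._≤ δ) (ℚₚ.+-identityˡ _) (≤-shift {b = seq x n} 0≤x+δ)) (approx 0≲x 0<δ)

  bound : x ≲ 0ℝ ⊎ y ≲ z → Eventually (λ n → seq (x * y) n ℚ.≤ seq (x * z) n ℚ.+ ε)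
  -- Together with `0ℝ ≲ x` this keeps the entries of `x` within `δ` of zero, so the crude bound `C`
  -- on `y - z` is enough.
  bound (inj₁ x≲0) = eventually-map₂ factor′ (proj₂ (proj₂ C-bounds))
      (eventually-map₂ (λ _ → ∣p∣≤q) x≤δ -x≤δ)
    where
    x≤δ : Eventually (λ n → seq x n ℚ.≤ δ)
    x≤δ = eventually-map (λ n → subst (seq x n ℚ.≤_) (ℚₚ.+-identityˡ δ)) (approx x≲0 0<δ)
    factor′ = λ n w≤C x≤δ → factor n (ℚₚ.≤-trans (∣p∣∣q∣-bound x≤δ w≤C) δC≤ε)
  bound (inj₂ y≲z) = eventually-map₂ (λ { n (w≤C , x≤B) (w≤δ , -x≤δ) → factor n (cases n w≤C x≤B w≤δ -x≤δ) })
      (eventually-map₂ (λ _ → _,_) (proj₂ (proj₂ C-bounds)) (proj₂ (proj₂ B-bounds)))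
      (eventually-map₂ (λ _ → _,_) (eventually-map (λ _ → ≤-shift) (approx y≲z 0<δ)) -x≤δ)
    where
    cases : ∀ n → ℚ.∣ seq y n ℚ.- seq z n ∣ ℚ.≤ C → ℚ.∣ seq x n ∣ ℚ.≤ B →
      seq y n ℚ.- seq z n ℚ.≤ δ → ℚ.- seq x n ℚ.≤ δ →
      seq x n ℚ.* (seq y n ℚ.- seq z n) ℚ.≤ ε
    -- `0ℝ ≲ x` permits slightly negative entries. These are at most `δ` in absolute value, and `C`
    -- bounds the other factor.
    cases n w≤C x≤B w≤δ -x≤δ with ℚₚ.≤-total 0ℚ (seq x n)
    ... | inj₁ 0≤x = ℚₚ.≤-trans
      (nonNeg-product-bound 0≤x (ℚₚ.≤-trans (p≤∣p∣ (seq x n)) x≤B) 0≤δ w≤δ) Bδ≤ε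
    ... | inj₂ x≤0 = ℚₚ.≤-trans
      (∣p∣∣q∣-bound (∣p∣≤q (ℚₚ.≤-trans x≤0 0≤δ) -x≤δ) w≤C) δC≤ε

-- Finite sums of reals and sums over decisions.

sum-mono-≲ : ∀ {k} {x y : Fin k → ℝ} → (∀ i → x i ≲ y i) → sum x ≲ sum y
sum-mono-≲ {zero}  x≲y = ≡⇒≲ λ _ → refl
sum-mono-≲ {suc k} x≲y = +-mono-≲ (x≲y zero) (sum-mono-≲ (x≲y ∘ suc))

-- Stated index by index: the operations on `ℝ` act entrywise, so identities become equalities in
-- `ℚ`, which `≡⇒≲` and `≡⇒≈` lift back to reals.
seq-*-distribʳ-sum : ∀ {k} (x : Fin k → ℝ) y n → seq (sum (λ i → x i * y)) n ≡ seq (sum x * y) n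
seq-*-distribʳ-sum {zero}  x y n = sym (ℚₚ.*-zeroˡ (seq y n))
seq-*-distribʳ-sum {suc k} x y n = trans
  (cong (seq (x zero * y) n ℚ.+_) (seq-*-distribʳ-sum (x ∘ suc) y n))
  (sym (ℚₚ.*-distribʳ-+ (seq y n) (seq (x zero) n) (seq (sum (x ∘ suc)) n)))

seq-sum-zero : ∀ {k} (x : Fin k → ℝ) n → (∀ i → seq (x i) n ≡ 0ℚ) → seq (sum x) n ≡ 0ℚ
seq-sum-zero {zero}  x n x≡0 = refl
seq-sum-zero {suc k} x n x≡0 = cong₂ ℚ._+_ (x≡0 zero) (seq-sum-zero (x ∘ suc) n (x≡0 ∘ suc))

seq-sum-single : ∀ {k} (x : Fin k → ℝ) i n → (∀ j → j ≢ i → seq (x j) n ≡ 0ℚ) →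
  seq (sum x) n ≡ seq (x i) n
seq-sum-single x zero    n x≡0 = trans
  (cong (seq (x zero) n ℚ.+_) (seq-sum-zero (x ∘ suc) n (λ i → x≡0 (suc i) λ ())))
  (ℚₚ.+-identityʳ (seq (x zero) n))
seq-sum-single x (suc i) n x≡0 = trans
  (cong₂ ℚ._+_ (x≡0 zero λ ()) (seq-sum-single (x ∘ suc) i n (λ j j≢i → x≡0 (suc j) λ { refl → j≢i refl })))
  (ℚₚ.+-identityˡ (seq (x (suc i)) n))

fromℕ : ℕ → ℝ
fromℕ n = fromℚ (ι n)

0≲fromℕ : ∀ n → 0ℝ ≲ fromℕ n
0≲fromℕ n = fromℚ-mono-≤ (0≤ι n)

-- This is the shape of one recursion step of `expectation` and `arrivalCountProb` at arrival
-- probability 1, where the branch without an arrival vanishes.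
seq-certain : ∀ p q → (1ℚ ℚ.- 1ℚ) ℚ.* p ℚ.+ 1ℚ ℚ.* q ≡ q
seq-certain p q = trans (cong₂ ℚ._+_ (ℚₚ.*-zeroˡ p) (ℚₚ.*-identityˡ q)) (ℚₚ.+-identityˡ q)

sumDecisions-mono-≲ : ∀ {m} {x y : Decision m → ℝ} → (∀ d → x d ≲ y d) →
  sumDecisions x ≲ sumDecisions y
sumDecisions-mono-≲ x≲y = +-mono-≲ (x≲y reject) (sum-mono-≲ (x≲y ∘ assign))

seq-sumDecisions-*ʳ : ∀ {m} (x : Decision m → ℝ) y n →
  seq (sumDecisions (λ d → x d * y)) n ≡ seq (sumDecisions x * y) n
seq-sumDecisions-*ʳ x y n = trans
  (cong (seq (x reject * y) n ℚ.+_) (seq-*-distribʳ-sum (x ∘ assign) y n))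
  (sym (ℚₚ.*-distribʳ-+ (seq y n) (seq (x reject) n) (seq (sum (x ∘ assign)) n)))

assign-injective : ∀ {m} {i j : Fin m} → assign i ≡ assign j → i ≡ j
assign-injective refl = refl

seq-sumDecisions-single : ∀ {m} (x : Decision m → ℝ) d n → (∀ e → e ≢ d → seq (x e) n ≡ 0ℚ) →
  seq (sumDecisions x) n ≡ seq (x d) n
seq-sumDecisions-single x reject     n x≡0 = trans
  (cong (seq (x reject) n ℚ.+_) (seq-sum-zero (x ∘ assign) n (λ i → x≡0 (assign i) λ ())))
  (ℚₚ.+-identityʳ (seq (x reject) n))
seq-sumDecisions-single x (assign i) n x≡0 = trans
  (cong₂ ℚ._+_ (x≡0 reject λ ())
    (seq-sum-single (x ∘ assign) i n (λ j j≢i → x≡0 (assign j) (j≢i ∘ assign-injective))))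
  (ℚₚ.+-identityˡ (seq (x (assign i)) n))

_≟ᵈ_ : ∀ {m} → DecidableEquality (Decision m)
reject   ≟ᵈ reject   = yes refl
reject   ≟ᵈ assign _ = no λ ()
assign _ ≟ᵈ reject   = no λ ()
assign i ≟ᵈ assign j with i ≟ᶠ j
... | yes refl = yes refl
... | no  i≢j  = no (i≢j ∘ assign-injective)

indicator : ∀ {P : Set} → Dec P → ℝ
indicator (yes _) = 1ℝ
indicator (no  _) = 0ℝ

indicator-yes : ∀ {P : Set} (P? : Dec P) → P → indicator P? ≡ 1ℝ
indicator-yes (yes _) _ = refl
indicator-yes (no ¬p) p = contradiction p ¬p

indicator-no : ∀ {P : Set} (P? : Dec P) → ¬ P → indicator P? ≡ 0ℝ
indicator-no (yes p) ¬p = contradiction p ¬p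
indicator-no (no _)  _  = refl

-- Expectations when a customer arrives in every period.

module _ (I : Instance) where
  open Instance I

  seq-expectation-certain : ∀ π X n h k →
    seq (expectation I π X {suc n} (λ _ → 1ℝ) h) k
      ≡ seq (sumDecisions (λ d → prob π h d * expectation I π X {n} (λ _ → 1ℝ) (arrived d ∷ h))) k
  seq-expectation-certain π X n h k =
    seq-certain (seq (expectation I π X {n} (λ _ → 1ℝ) (noArrival ∷ h)) k) _

  -- Good need only hold along histories of positive probability; its index is
  -- the number of remaining periods.
  expectation-≲ : ∀ π {X M} (Good : ℕ → History m → Set) → 0ℝ ≲ M →
    (∀ n h d → Good (suc n) h → prob π h d ≲ 0ℝ ⊎ Good n (arrived d ∷ h)) →
    (∀ h → Good 0 h → X h ≲ M) →
    ∀ n h → Good n h → expectation I π X {n} (λ _ → 1ℝ) h ≲ M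
  expectation-≲ π {X} {M} Good 0≲M step end zero    h good = end h good
  expectation-≲ π {X} {M} Good 0≲M step end (suc n) h good =
    ≲-trans (≡⇒≲ (seq-expectation-certain π X n h))
    -- With every outcome bounded by `M`, the weighted sum becomes `M` times the total probability,
    -- which is 1.
    (≲-trans (sumDecisions-mono-≲ {y = λ d → prob π h d * M} outcome)
    (≲-trans {y = M * sumDecisions (prob π h)}
      (≡⇒≲ λ k → trans (seq-sumDecisions-*ʳ (prob π h) M k) (ℚₚ.*-comm (seq (sumDecisions (prob π h)) k) (seq M k)))
    (≲-trans (*-monoʳ-≲ {z = 1ℝ} 0≲M (inj₂ (≈⇒≲ (prob-sum π h))))
      (≡⇒≲ λ k → ℚₚ.*-identityʳ (seq M k)))))
    where
    outcome : ∀ d → prob π h d * expectation I π X {n} (λ _ → 1ℝ) (arrived d ∷ h) ≲ prob π h d * M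
    outcome d with step n h d good
    -- The value of this outcome is uncontrolled; its zero weight alone gives the bound.
    ... | inj₁ p≲0   = *-monoʳ-≲ (≤⇒≲ (prob-nonNeg π h d)) (inj₁ p≲0)
    ... | inj₂ good′ = *-monoʳ-≲ (≤⇒≲ (prob-nonNeg π h d))
      (inj₂ (expectation-≲ π Good 0≲M step end n (arrived d ∷ h) good′))

  module Deterministic (rule : History m → Decision m)
    (rule-feasible : ∀ h i → rule h ≡ assign i → Available I h i) where

    algorithm : OnlineAlgorithm I
    algorithm .prob h d = indicator (rule h ≟ᵈ d)
    algorithm .prob-nonNeg h d with rule h ≟ᵈ d
    ... | yes _ = ≲⇒≤ (fromℚ-mono-≤ 0≤1ℚ)
    ... | no  _ = ≲⇒≤ (fromℚ-mono-≤ {0ℚ} ℚₚ.≤-refl)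
    algorithm .prob-sum h = ≡⇒≈ (sumDecisions λ d → indicator (rule h ≟ᵈ d)) 1ℝ λ n → trans
      (seq-sumDecisions-single (λ d → indicator (rule h ≟ᵈ d)) (rule h) n
        λ d d≢ → cong (λ x → seq x n) (indicator-no (rule h ≟ᵈ d) (d≢ ∘ sym)))
      (cong (λ x → seq x n) (indicator-yes (rule h ≟ᵈ rule h) refl))
    algorithm .feasible h i ¬avail = ≡⇒≈ (indicator (rule h ≟ᵈ assign i)) 0ℝ λ n → cong (λ x → seq x n)
      (indicator-no (rule h ≟ᵈ assign i) (¬avail ∘ rule-feasible h i))

    prob-pos⇒rule : ∀ h d → 0ℝ < prob algorithm h d → rule h ≡ d
    prob-pos⇒rule h d 0<p with rule h ≟ᵈ d
    ... | yes eq = eq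
    ... | no  _  = contradiction 0<p (≲⇒≤ (fromℚ-mono-≤ {0ℚ} ℚₚ.≤-refl))

    -- All other decisions have weight zero, so a deterministic algorithm can be followed along a
    -- single history.
    seq-expectation-rule : ∀ X n h k →
      seq (expectation I algorithm X {suc n} (λ _ → 1ℝ) h) k
        ≡ seq (expectation I algorithm X {n} (λ _ → 1ℝ) (arrived (rule h) ∷ h)) k
    seq-expectation-rule X n h k = begin
      seq (expectation I algorithm X {suc n} (λ _ → 1ℝ) h) k
        ≡⟨ seq-expectation-certain algorithm X n h k ⟩
      seq (sumDecisions outcome) k
        ≡⟨ seq-sumDecisions-single outcome (rule h) k
             (λ d d≢ → trans (cong (λ x → seq (x * E d) k) (indicator-no (rule h ≟ᵈ d) (d≢ ∘ sym)))
                             (ℚₚ.*-zeroˡ (seq (E d) k))) ⟩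
      seq (outcome (rule h)) k
        ≡⟨ trans (cong (λ x → seq (x * E (rule h)) k) (indicator-yes (rule h ≟ᵈ rule h) refl))
                 (ℚₚ.*-identityˡ (seq (E (rule h)) k)) ⟩
      seq (E (rule h)) k ∎
      where
      open ≡-Reasoning
      E = λ d → expectation I algorithm X {n} (λ _ → 1ℝ) (arrived d ∷ h)
      outcome = λ d → prob algorithm h d * E d

-- Sales as positions in a history, maximisation, and triangular numbers.

sold⇒∈ : ∀ {m} (h : History m) i → sold h i ≢ 0 → ∃[ k ] lookup h k ≡ arrived (assign i)
sold⇒∈ []                        i sold≢0 = contradiction refl sold≢0
sold⇒∈ (noArrival          ∷ h) i sold≢0 with sold⇒∈ h i sold≢0
... | k , eq = suc k , eq
sold⇒∈ (arrived reject     ∷ h) i sold≢0 with sold⇒∈ h i sold≢0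
... | k , eq = suc k , eq
sold⇒∈ (arrived (assign j) ∷ h) i sold≢0 with j ≟ᶠ i
... | yes refl = zero , refl
... | no  _ with sold⇒∈ h i sold≢0
... | k , eq = suc k , eq

-- If every trap were sold, choosing a position of sale for each would map `T` traps into fewer than
-- `T` positions. Two traps would then share a position, but the event there names only one product.
unsold-product : ∀ {T} (h : History (suc T)) → length h ℕ.< T → ∃[ j ] sold h (suc j) ≡ 0
unsold-product h short with any? (λ j → sold h (suc j) ℕₚ.≟ 0)
... | yes found = found
... | no  ¬found with pigeonhole short (λ j → proj₁ (sold⇒∈ h (suc j) (λ eq → ¬found (j , eq))))
... | i , j , i<j , same = contradiction (trans (sym (at i)) (trans (cong (lookup h) same) (at j)))
    (λ { refl → ℕₚ.<-irrefl refl i<j })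
  where at = λ j → proj₂ (sold⇒∈ h (suc j) (λ eq → ¬found (j , eq)))

-- The values lie in `ℕ` because comparison is decidable there, unlike on `ℝ`; `greedyChoice`
-- transfers the maximum to real rewards.
argmax : ∀ {k} {P : Fin k → Set} → (∀ i → Dec (P i)) → (v : Fin k → ℕ) →
  (∀ i → ¬ P i) ⊎ ∃[ i ] (P i × (∀ j → P j → v j ℕ.≤ v i))
argmax {zero}  P? v = inj₁ λ ()
argmax {suc k} P? v with P? zero | argmax (P? ∘ suc) (v ∘ suc)
... | no ¬p | inj₁ none = inj₁ λ { zero → ¬p ; (suc i) → none i }
... | no ¬p | inj₂ (i , pi , max) = inj₂ (suc i , pi , λ { zero p → contradiction p ¬p ; (suc j) → max j })
... | yes p | inj₁ none = inj₂ (zero , p , λ { zero _ → ℕₚ.≤-refl ; (suc j) q → contradiction q (none j) })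
... | yes p | inj₂ (i , pi , max) with ℕₚ.≤-total (v zero) (v (suc i))
... | inj₁ v₀≤vᵢ = inj₂ (suc i , pi , λ { zero _ → v₀≤vᵢ ; (suc j) → max j })
... | inj₂ vᵢ≤v₀ = inj₂ (zero , p , λ { zero _ → ℕₚ.≤-refl ; (suc j) q → ℕₚ.≤-trans (max j q) vᵢ≤v₀ })

tri : ℕ → ℕ
tri zero    = 0
tri (suc n) = suc n ℕ.+ tri n

-- For `T = 4q` the triangular number `T(T+1)/2` is `2q(4q+1)`. So the optimum is exactly `q` times
-- greedy's `2T` enlarged by 2, a margin that `fromℕ-<-scaled` uses up.
tri-q*4 : ∀ q → tri (q ℕ.* 4) ≡ q ℕ.* (2 ℕ.+ (q ℕ.* 4 ℕ.+ q ℕ.* 4))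
tri-q*4 zero    = refl
tri-q*4 (suc q) = trans
  -- Raising `q` by one adds four terms to the triangular sum.
  (cong (λ t → (4 ℕ.+ q ℕ.* 4) ℕ.+ ((3 ℕ.+ q ℕ.* 4) ℕ.+ ((2 ℕ.+ q ℕ.* 4) ℕ.+ ((1 ℕ.+ q ℕ.* 4) ℕ.+ t)))) (tri-q*4 q))
  (solve 1 (λ q → (con 4 :+ q :* con 4) :+ ((con 3 :+ q :* con 4) :+ ((con 2 :+ q :* con 4) :+ ((con 1 :+ q :* con 4)
      :+ q :* (con 2 :+ (q :* con 4 :+ q :* con 4)))))
    := (con 1 :+ q) :* (con 2 :+ ((con 4 :+ q :* con 4) :+ (con 4 :+ q :* con 4)))) refl q)
  where open ℕ-Solver.+-*-Solver

tri-mono-≤ : ∀ {a b} → a ℕ.≤ b → tri a ℕ.≤ tri b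
tri-mono-≤ ℕ.z≤n       = ℕ.z≤n
tri-mono-≤ (ℕ.s≤s a≤b) = ℕₚ.+-mono-≤ (ℕ.s≤s a≤b) (tri-mono-≤ a≤b)

-- Fails for a = 0 and b = 1 or 2: selling one or two traps beats product 0.
tri-+-double : ∀ a b → 3 ℕ.≤ a ℕ.+ b → tri a ℕ.+ (b ℕ.+ b) ℕ.≤ tri (a ℕ.+ b)
tri-+-double a zero    _ = ℕₚ.≤-reflexive (trans (ℕₚ.+-identityʳ (tri a)) (cong tri (sym (ℕₚ.+-identityʳ a))))
tri-+-double a (suc b) 3≤a+1+b with 3 ℕₚ.≤? a ℕ.+ b
... | yes 3≤a+b = begin
  tri a ℕ.+ (suc b ℕ.+ suc b)      ≡⟨ solve 2 (λ t b → t :+ ((con 1 :+ b) :+ (con 1 :+ b)) := con 2 :+ (t :+ (b :+ b))) refl (tri a) b ⟩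
  -- One more trap adds 2 on the left, while the right side grows by `suc (a + b)`, which is at
  -- least 2.
  2 ℕ.+ (tri a ℕ.+ (b ℕ.+ b))      ≤⟨ ℕₚ.+-mono-≤ (ℕₚ.m≤n⇒m≤1+n (ℕₚ.<⇒≤ 3≤a+b)) (tri-+-double a b 3≤a+b) ⟩
  tri (suc (a ℕ.+ b))              ≡⟨ cong tri (ℕₚ.+-suc a b) ⟨
  tri (a ℕ.+ suc b)                ∎
  where
  open ℕₚ.≤-Reasoning
  open ℕ-Solver.+-*-Solver
-- Now `a + b` is at most 2, so the total `a + suc b` must be exactly 3. The three such cases read 6
-- ≤ 6, 5 ≤ 6 and 5 ≤ 6; all other patterns are contradictory.
tri-+-double 0 1 (ℕ.s≤s ())         | no _
tri-+-double 0 2 (ℕ.s≤s (ℕ.s≤s ())) | no _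
tri-+-double 1 1 (ℕ.s≤s (ℕ.s≤s ())) | no _
tri-+-double 0 3 _ | no _ = ℕₚ.≤-refl
tri-+-double 1 2 _ | no _ = ℕₚ.m≤m+n 5 1
tri-+-double 2 1 _ | no _ = ℕₚ.m≤m+n 5 1
tri-+-double 0 (suc (suc (suc (suc b)))) _ | no 3≰a+b = contradiction (ℕₚ.m≤m+n 3 b) 3≰a+b
tri-+-double 1 (suc (suc (suc b)))       _ | no 3≰a+b = contradiction (ℕₚ.m≤m+n 3 b) 3≰a+b
tri-+-double 2 (suc (suc b))             _ | no 3≰a+b = contradiction (ℕₚ.m≤m+n 3 b) 3≰a+b
tri-+-double (suc (suc (suc a))) (suc b) _ | no 3≰a+b = contradiction (ℕₚ.m≤m+n 3 (a ℕ.+ b)) 3≰a+b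

-- The instance: linear bonus and certain arrivals.

≈-refl : ∀ x → x ≈ x
≈-refl x = ≡⇒≈ x x λ _ → refl

arrivalCountProb-certain : ∀ T n → seq (arrivalCountProb {T} (λ _ → 1ℝ) T) n ≡ 1ℚ
arrivalCountProb-certain zero    n = refl
arrivalCountProb-certain (suc T) n = trans
  (seq-certain (seq (arrivalCountProb {T} (λ _ → 1ℝ) (suc T)) n) _) (arrivalCountProb-certain T n)

linear-isBonus : IsBonus fromℕ
linear-isBonus = record
  { vanishes-at-0 = ≈-refl 0ℝ
  ; nonNegative   = λ k → ≲⇒≤ (0≲fromℕ k)
  ; nondecreasing = λ k≤l → ≲⇒≤ (fromℚ-mono-≤ (ι-mono-≤ k≤l))
  }

-- Linear functions have constant increments, so concavity holds with equality.
linear-concave : ∀ b → DiscreteConcaveUpTo b fromℕ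
linear-concave b k _ = ≲⇒≤ {fromℕ (2 ℕ.+ k) - fromℕ (suc k)} {fromℕ (suc k) - fromℕ k}
  (≡⇒≲ λ _ → increment (ι k))
  where
  open ℚ-Solver.+-*-Solver
  increment : ∀ p → (1ℚ ℚ.+ (1ℚ ℚ.+ p)) ℚ.- (1ℚ ℚ.+ p) ≡ (1ℚ ℚ.+ p) ℚ.- p
  increment = solve 1 (λ p → (con 1ℚ :+ (con 1ℚ :+ p)) :- (con 1ℚ :+ p) := (con 1ℚ :+ p) :- p) refl

baseReward : ∀ {T} → Fin (suc T) → ℕ
baseReward zero    = 0
baseReward (suc _) = 1

trap : ℕ → Instance
trap T = record
  { m             = suc T
  ; capacity      = λ { zero → T ; (suc _) → 1 }
  ; reward        = fromℕ ∘ baseReward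
  ; bonus         = λ _ → fromℕ
  ; T             = T
  ; arrival       = λ _ → 1ℝ
  ; reward-nonNeg = λ i → ≲⇒≤ (0≲fromℕ (baseReward i))
  ; bonus-isBonus = λ _ → linear-isBonus
  ; arrival-prob  = λ _ → ≲⇒≤ (fromℚ-mono-≤ 0≤1ℚ) , ≲⇒≤ (fromℚ-mono-≤ {1ℚ} ℚₚ.≤-refl)
  }

-- Integer rewards, a greedy algorithm, and the algorithm selling only product 0.

module Trap (T : ℕ) where

  I : Instance
  I = trap T

  open Instance I using (capacity)

  available? : ∀ h i → Dec (Available I h i)
  available? h i = sold h i ℕₚ.<? capacity i

  -- Integer counterpart of `nextReward`, as `total` is of `Rev`. Choices and bounds are settled in
  -- `ℕ` and carried to `ℝ` by `ι`.
  gain : History (suc T) → Fin (suc T) → ℕ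
  gain h i = baseReward i ℕ.+ suc (sold h i)

  total : History (suc T) → ℕ
  total []                        = 0
  total (noArrival          ∷ h) = total h
  total (arrived reject     ∷ h) = total h
  total (arrived (assign i) ∷ h) = total h ℕ.+ gain h i

  nextReward-gain : ∀ h i n → seq (nextReward I h i) n ≡ ι (gain h i)
  nextReward-gain h i n = sym (ι-+ (baseReward i) (suc (sold h i)))

  Rev-total : ∀ h n → seq (Rev I h) n ≡ ι (total h)
  Rev-total []                        n = refl
  Rev-total (noArrival          ∷ h) n = Rev-total h n
  Rev-total (arrived reject     ∷ h) n = Rev-total h n
  Rev-total (arrived (assign i) ∷ h) n = trans
    (cong₂ ℚ._+_ (Rev-total h n) (nextReward-gain h i n)) (sym (ι-+ (total h) (gain h i)))

  Rev-≲ : ∀ h {n} → total h ℕ.≤ n → Rev I h ≲ fromℕ n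
  Rev-≲ h le = ≲-trans (≡⇒≲ {y = fromℕ (total h)} (Rev-total h)) (fromℚ-mono-≤ (ι-mono-≤ le))

  gain-≤⇒nextReward-≤ : ∀ h i j → gain h i ℕ.≤ gain h j → nextReward I h i ≤ nextReward I h j
  gain-≤⇒nextReward-≤ h i j le = ≲⇒≤ {nextReward I h i} {nextReward I h j}
    (≲-trans (≡⇒≲ {y = fromℕ (gain h i)} (nextReward-gain h i))
    (≲-trans (fromℚ-mono-≤ (ι-mono-≤ le))
      (≡⇒≲ {x = fromℕ (gain h j)} λ n → sym (nextReward-gain h j n))))

  gain-<⇒nextReward-< : ∀ h i j → gain h i ℕ.< gain h j → nextReward I h i < nextReward I h j
  -- Distinct integers differ by at least 1, which leaves ½ as a gap that is exceeded strictly.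
  gain-<⇒nextReward-< h i j lt = ½ , ℚₚ.positive⁻¹ ½ , 0 , λ n _ → begin-strict
    seq (nextReward I h i) n ℚ.+ ½   ≡⟨ cong (ℚ._+ ½) (nextReward-gain h i n) ⟩
    ι (gain h i) ℚ.+ ½               <⟨ ℚₚ.+-monoʳ-< (ι (gain h i)) ½<1 ⟩
    ι (gain h i) ℚ.+ 1ℚ              ≡⟨ ℚₚ.+-comm (ι (gain h i)) 1ℚ ⟩
    ι (suc (gain h i))               ≤⟨ ι-mono-≤ lt ⟩
    ι (gain h j)                     ≡⟨ nextReward-gain h j n ⟨
    seq (nextReward I h j) n         ∎
    where
    open ℚₚ.≤-Reasoning
    ½<1 : ½ ℚ.< 1ℚ
    ½<1 = ℚₚ.+-monoʳ-< ½ (ℚₚ.positive⁻¹ ½)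

  greedyChoice : ∀ h → ∃[ d ] IsGreedyDecision I h d
  greedyChoice h with argmax (available? h) (gain h)
  ... | inj₁ none            = reject , none
  ... | inj₂ (i , avail , max) = assign i , avail ,
    λ j avail′ → gain-≤⇒nextReward-≤ h j i (max j avail′)

  module Greedy = Deterministic I (proj₁ ∘ greedyChoice)
    (λ h i eq → proj₁ (subst (IsGreedyDecision I h) eq (proj₂ (greedyChoice h))))

  -- Ensures that the bound over all greedy algorithms is not vacuous.
  greedy-isMyopicGreedy : IsMyopicGreedy I Greedy.algorithm
  greedy-isMyopicGreedy h d 0<p =
    subst (IsGreedyDecision I h) (Greedy.prob-pos⇒rule h d 0<p) (proj₂ (greedyChoice h))

  -- Rejection makes the rule feasible on every history; on its own run of `T` periods the capacity
  -- `T` is never exhausted beforehand.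
  focusRule : History (suc T) → Decision (suc T)
  focusRule h with available? h zero
  ... | yes _ = assign zero
  ... | no  _ = reject

  focusRule-feasible : ∀ h i → focusRule h ≡ assign i → Available I h i
  focusRule-feasible h i eq with available? h zero | eq
  ... | yes avail | refl = avail
  ... | no  _     | ()

  focusRule-available : ∀ h → Available I h zero → focusRule h ≡ assign zero
  focusRule-available h avail with available? h zero
  ... | yes _     = refl
  ... | no ¬avail = contradiction avail ¬avail

  module Focus = Deterministic I focusRule focusRule-feasible

  -- The first hypothesis says that, with `n` periods left, the units of product 0 left are just
  -- enough for them. Each sale pays one more than the previous one, which is the increment of
  -- `tri`.
  focus-expectation : ∀ n h → sold h zero ℕ.+ n ≡ T → total h ≡ tri (sold h zero) → ∀ k →
    seq (expectation I Focus.algorithm (Rev I) {n} (λ _ → 1ℝ) h) k ≡ ι (tri T)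
  focus-expectation zero    h sold≡ total≡ k = begin
    seq (Rev I h) k      ≡⟨ Rev-total h k ⟩
    ι (total h)          ≡⟨ cong ι total≡ ⟩
    ι (tri (sold h zero))  ≡⟨ cong (ι ∘ tri) (trans (sym (ℕₚ.+-identityʳ (sold h zero))) sold≡) ⟩
    ι (tri T)            ∎
    where open ≡-Reasoning
  focus-expectation (suc n) h sold≡ total≡ k = begin
    seq (expectation I Focus.algorithm (Rev I) {suc n} (λ _ → 1ℝ) h) k
      ≡⟨ Focus.seq-expectation-rule (Rev I) n h k ⟩
    seq (E (focusRule h)) k
      ≡⟨ cong (λ d → seq (E d) k) (focusRule-available h (ℕₚ.m+n≤o⇒m≤o (suc (sold h zero)) (ℕₚ.≤-reflexive sold′≡))) ⟩
    seq (E (assign zero)) k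
      ≡⟨ focus-expectation n (arrived (assign zero) ∷ h) sold′≡
           (trans (ℕₚ.+-comm (total h) (suc (sold h zero))) (cong (suc (sold h zero) ℕ.+_) total≡)) k ⟩
    ι (tri T) ∎
    where
    open ≡-Reasoning
    E = λ d → expectation I Focus.algorithm (Rev I) {n} (λ _ → 1ℝ) (arrived d ∷ h)
    sold′≡ : suc (sold h zero) ℕ.+ n ≡ T
    sold′≡ = trans (sym (ℕₚ.+-suc (sold h zero) n)) sold≡

  focus-𝔼Rev : ∀ k → seq (𝔼Rev I Focus.algorithm) k ≡ ι (tri T)
  focus-𝔼Rev = focus-expectation T [] refl refl

  -- The optimum: an upper bound for every algorithm.

  infeasible : ∀ (π : OnlineAlgorithm I) h i → ¬ Available I h i → prob π h (assign i) ≲ 0ℝ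
  infeasible π h i ¬avail = ≈⇒≲ {prob π h (assign i)} {0ℝ} (feasible π h i ¬avail)

  next-period : ∀ (h : History (suc T)) n → length h ℕ.+ suc n ≡ T → suc (length h) ℕ.+ n ≡ T
  next-period h n len = trans (sym (ℕₚ.+-suc (length h) n)) len

  m<1⇒m≡0 : ∀ {m} → m ℕ.< 1 → m ≡ 0
  m<1⇒m≡0 (ℕ.s≤s ℕ.z≤n) = refl

  gain-unsold-trap : ∀ h j → sold h (suc j) ≡ 0 → gain h (suc j) ≡ 2
  gain-unsold-trap h j = cong (2 ℕ.+_)

  -- s is the number of traps sold.
  Bounded : ℕ → History (suc T) → Set
  Bounded n h = length h ℕ.+ n ≡ T
    × ∃[ s ] (sold h zero ℕ.+ s ℕ.≤ length h × total h ℕ.≤ tri (sold h zero) ℕ.+ (s ℕ.+ s))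

  -- A sale of product 0 pays exactly the increment of `tri`. An available trap is unsold, having
  -- capacity 1, and pays 2; a sold-out trap is chosen with probability zero. A rejection only
  -- loosens the count of sales.
  bounded-step : ∀ (π : OnlineAlgorithm I) n h d → Bounded (suc n) h → prob π h d ≲ 0ℝ ⊎ Bounded n (arrived d ∷ h)
  bounded-step π n h reject (len , s , sales , rev) =
    inj₂ (next-period h n len , s , ℕₚ.m≤n⇒m≤1+n sales , rev)
  bounded-step π n h (assign zero) (len , s , sales , rev) =
    inj₂ (next-period h n len , s , ℕ.s≤s sales , (begin
      total h ℕ.+ suc a                      ≤⟨ ℕₚ.+-monoˡ-≤ (suc a) rev ⟩
      (tri a ℕ.+ (s ℕ.+ s)) ℕ.+ suc a        ≡⟨ ℕₚ.+-comm _ (suc a) ⟩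
      suc a ℕ.+ (tri a ℕ.+ (s ℕ.+ s))        ≡⟨ ℕₚ.+-assoc (suc a) (tri a) (s ℕ.+ s) ⟨
      tri (suc a) ℕ.+ (s ℕ.+ s)              ∎))
    where
    open ℕₚ.≤-Reasoning
    a = sold h zero
  bounded-step π n h (assign (suc j)) (len , s , sales , rev) with available? h (suc j)
  ... | no ¬avail = inj₁ (infeasible π h (suc j) ¬avail)
  ... | yes avail = inj₂ (next-period h n len , suc s
    , subst (ℕ._≤ suc (length h)) (sym (ℕₚ.+-suc a s)) (ℕ.s≤s sales) , (begin
      total h ℕ.+ gain h (suc j)             ≡⟨ cong (total h ℕ.+_) (gain-unsold-trap h j (m<1⇒m≡0 avail)) ⟩
      total h ℕ.+ 2                          ≤⟨ ℕₚ.+-monoˡ-≤ 2 rev ⟩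
      (tri a ℕ.+ (s ℕ.+ s)) ℕ.+ 2            ≡⟨ solve 2 (λ t s → (t :+ (s :+ s)) :+ con 2 := t :+ ((con 1 :+ s) :+ (con 1 :+ s))) refl (tri a) s ⟩
      tri a ℕ.+ (suc s ℕ.+ suc s)            ∎))
    where
    open ℕₚ.≤-Reasoning
    open ℕ-Solver.+-*-Solver
    a = sold h zero

  𝔼Rev-≲-tri : 3 ℕ.≤ T → ∀ π → 𝔼Rev I π ≲ fromℕ (tri T)
  𝔼Rev-≲-tri 3≤T π = expectation-≲ I π Bounded (0≲fromℕ (tri T)) (bounded-step π) end T []
    (refl , 0 , ℕ.z≤n , ℕ.z≤n)
    where
    open ℕₚ.≤-Reasoning
    end : ∀ h → Bounded 0 h → Rev I h ≲ fromℕ (tri T)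
    end h (len , s , sales , rev) = Rev-≲ h (begin
      total h                   ≤⟨ rev ⟩
      -- Raising `s` to `T ∸ a`, as if all rejected customers had bought traps, makes the two counts
      -- add up to `T`, as `tri-+-double` requires.
      tri a ℕ.+ (s ℕ.+ s)       ≤⟨ ℕₚ.+-monoʳ-≤ (tri a) (ℕₚ.+-mono-≤ s≤T∸a s≤T∸a) ⟩
      tri a ℕ.+ (b ℕ.+ b)       ≤⟨ tri-+-double a b (subst (3 ℕ.≤_) (sym a+b≡T) 3≤T) ⟩
      tri (a ℕ.+ b)             ≡⟨ cong tri a+b≡T ⟩
      tri T                     ∎)
      where
      a = sold h zero
      b = T ℕ.∸ a
      a+s≤T : a ℕ.+ s ℕ.≤ T
      a+s≤T = subst (a ℕ.+ s ℕ.≤_) (trans (sym (ℕₚ.+-identityʳ (length h))) len) sales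
      a+b≡T : a ℕ.+ b ≡ T
      a+b≡T = ℕₚ.m+[n∸m]≡n (ℕₚ.m+n≤o⇒m≤o a a+s≤T)
      s≤T∸a : s ℕ.≤ b
      s≤T∸a = subst (ℕ._≤ b) (ℕₚ.m+n∸m≡n a s) (ℕₚ.∸-monoˡ-≤ a a+s≤T)

  -- The supremum is attained by `Focus.algorithm`, which therefore serves as the approximating
  -- element for every `y` below it.
  tri-isOPTon : 3 ℕ.≤ T → IsOPTon I (fromℕ (tri T))
  tri-isOPTon 3≤T = (λ π → ≲⇒≤ (𝔼Rev-≲-tri 3≤T π)) , λ y (ε , 0<ε , N , below) → Focus.algorithm
    , ε , 0<ε , N , λ n N≤n → subst (seq y n ℚ.+ ε ℚ.<_) (sym (focus-𝔼Rev n)) (below n N≤n)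

  -- An upper bound for every greedy algorithm.

  Trapped : ℕ → History (suc T) → Set
  Trapped n h = length h ℕ.+ n ≡ T × sold h zero ≡ 0 × total h ℕ.≤ length h ℕ.+ length h

  -- Before the horizon ends some trap is unsold and pays 2, against 1 for the still unsold product
  -- 0. Hence product 0 never becomes a greedy choice, however ties are broken, and each period
  -- earns at most 2.
  trapped-step : ∀ π → IsMyopicGreedy I π →
    ∀ n h d → Trapped (suc n) h → prob π h d ≲ 0ℝ ⊎ Trapped n (arrived d ∷ h)
  trapped-step π greedy n h reject (len , sold₀ , rev) =
    inj₂ (next-period h n len , sold₀ , ℕₚ.≤-trans rev (ℕₚ.+-mono-≤ (ℕₚ.n≤1+n _) (ℕₚ.n≤1+n _)))
  -- Since `≤` is a negation, refuting positive probability already proves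
  -- `prob π h (assign zero) ≤ 0ℝ`.
  trapped-step π greedy n h (assign zero) (len , sold₀ , rev) = inj₁ (≤⇒≲ {prob π h (assign zero)} {0ℝ} λ 0<p →
    let j , unsold = unsold-product h (ℕₚ.m+n≤o⇒m≤o (suc (length h))
                       (ℕₚ.≤-reflexive (next-period h n len)))
        _ , best = greedy h (assign zero) 0<p
    in best (suc j) (ℕₚ.≤-reflexive (cong suc unsold))
         (gain-<⇒nextReward-< h zero (suc j) (ℕₚ.≤-reflexive
           (trans (cong (2 ℕ.+_) sold₀) (sym (gain-unsold-trap h j unsold))))))
  trapped-step π greedy n h (assign (suc j)) (len , sold₀ , rev) with available? h (suc j)
  ... | no ¬avail = inj₁ (infeasible π h (suc j) ¬avail)
  ... | yes avail = inj₂ (next-period h n len , sold₀ , (begin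
      total h ℕ.+ gain h (suc j)         ≡⟨ cong (total h ℕ.+_) (gain-unsold-trap h j (m<1⇒m≡0 avail)) ⟩
      total h ℕ.+ 2                      ≤⟨ ℕₚ.+-monoˡ-≤ 2 rev ⟩
      (l ℕ.+ l) ℕ.+ 2                    ≡⟨ solve 1 (λ l → (l :+ l) :+ con 2 := (con 1 :+ l) :+ (con 1 :+ l)) refl l ⟩
      suc l ℕ.+ suc l                    ∎))
    where
    open ℕₚ.≤-Reasoning
    open ℕ-Solver.+-*-Solver
    l = length h

  greedy-𝔼Rev-≲ : ∀ π → IsMyopicGreedy I π → 𝔼Rev I π ≲ fromℕ (T ℕ.+ T)
  greedy-𝔼Rev-≲ π greedy = expectation-≲ I π Trapped (0≲fromℕ (T ℕ.+ T)) (trapped-step π greedy) end T []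
    (refl , refl , ℕ.z≤n)
    where
    end : ∀ h → Trapped 0 h → Rev I h ≲ fromℕ (T ℕ.+ T)
    end h (len , _ , rev) = Rev-≲ h
      (subst (λ l → total h ℕ.≤ l ℕ.+ l) (trans (sym (ℕₚ.+-identityʳ (length h))) len) rev)

-- Choice of the horizon for a given constant.

fromℕ-<-scaled : ∀ {x c ε a q} b → x ≲ fromℕ a → 0ℚ ℚ.< ε →
  (∃[ N ] (∀ n → N ℕ.≤ n → 0ℚ ℚ.+ ε ℚ.< seq c n)) →
  1ℚ ℚ.≤ ε ℚ.* ι q → b ≡ q ℕ.* (2 ℕ.+ a) → 0 ℕ.< b → x < c * fromℕ b
-- Of the margin 2 in `2 + a`, one unit absorbs the tolerance in `x ≲ fromℕ a` and the other is the
-- gap witnessing `<`. The rest is `c * b > ε * q * (2 + a) ≥ 2 + a`.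
fromℕ-<-scaled {x} {c} {ε} {a} {q} b x≲a 0<ε ε<c 1≤εq b≡ 0<b = 1ℚ , 0<1ℚ ,
  eventually-map₂ (λ n x≤a+1 ε<cₙ → begin-strict
    seq x n ℚ.+ 1ℚ              ≤⟨ ℚₚ.+-monoˡ-≤ 1ℚ x≤a+1 ⟩
    (ι a ℚ.+ 1ℚ) ℚ.+ 1ℚ         ≡⟨ trans (ℚₚ.+-comm (ι a ℚ.+ 1ℚ) 1ℚ) (cong (1ℚ ℚ.+_) (ℚₚ.+-comm (ι a) 1ℚ)) ⟩
    ι (2 ℕ.+ a)                 ≡⟨ ℚₚ.*-identityˡ (ι (2 ℕ.+ a)) ⟨
    1ℚ ℚ.* ι (2 ℕ.+ a)          ≤⟨ ℚₚ.*-monoʳ-≤-nonNeg (ι (2 ℕ.+ a)) {{ℚ.nonNegative (0≤ι (2 ℕ.+ a))}} 1≤εq ⟩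
    (ε ℚ.* ι q) ℚ.* ι (2 ℕ.+ a) ≡⟨ ℚₚ.*-assoc ε (ι q) (ι (2 ℕ.+ a)) ⟩
    ε ℚ.* (ι q ℚ.* ι (2 ℕ.+ a)) ≡⟨ cong (ε ℚ.*_) (trans (cong ι b≡) (ι-* q (2 ℕ.+ a))) ⟨
    ε ℚ.* ι b                   <⟨ ℚₚ.*-monoˡ-<-pos (ι b) {{ℚ.positive (ι-mono-< 0<b)}}
                                     (subst (ℚ._< seq c n) (ℚₚ.+-identityˡ ε) ε<cₙ) ⟩
    seq c n ℚ.* ι b             ∎) (approx x≲a 0<1ℚ) ε<c
  where open ℚₚ.≤-Reasoning

GreedyBelow : ℝ → Instance → Set
GreedyBelow c I =
    HasCommonConcaveBonus I
  × HasDeterministicArrivalCount I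
  × Σ[ opt ∈ ℝ ]
      ( IsOPTon I opt
      × (∃[ π ] IsMyopicGreedy I π)
      × (∀ π → IsMyopicGreedy I π → 𝔼Rev I π < c * opt))

-- Stated for a variable T, since at T = suc _ comparing types would unfold the
-- expectations.
greedyBelow-instance : ∀ {c ε q} T → 0ℚ ℚ.< ε →
  Eventually (λ n → 0ℚ ℚ.+ ε ℚ.< seq c n) → 1ℚ ℚ.≤ ε ℚ.* ι q →
  3 ℕ.≤ T → tri T ≡ q ℕ.* (2 ℕ.+ (T ℕ.+ T)) → Σ[ I ∈ Instance ] GreedyBelow c I
greedyBelow-instance {c} {ε} {q} T 0<ε ε<c 1≤εq 3≤T tri≡ = trap T
  , (fromℕ , linear-isBonus , (λ i → linear-concave (Instance.capacity (trap T) i)) , λ _ k → ≈-refl (fromℕ k))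
  , (T , ≡⇒≈ (arrivalCountProb {T} (λ _ → 1ℝ) T) 1ℝ (arrivalCountProb-certain T))
  , fromℕ (tri T)
  , tri-isOPTon 3≤T
  , (Greedy.algorithm , greedy-isMyopicGreedy)
  , λ π greedy → fromℕ-<-scaled {𝔼Rev (trap T) π} {c} {ε} {T ℕ.+ T} {q} (tri T)
      (greedy-𝔼Rev-≲ π greedy) 0<ε ε<c 1≤εq tri≡ (ℕₚ.≤-trans (ℕ.s≤s ℕ.z≤n) (tri-mono-≤ 3≤T))
  where open Trap T

proposition4 : (c : ℝ) → 0ℝ < c →
    Σ[ I ∈ Instance ]
    ( HasCommonConcaveBonus I
    × HasDeterministicArrivalCount I
    × Σ[ opt ∈ ℝ ]
    ( IsOPTon I opt
    × (∃[ π ] IsMyopicGreedy I π)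
    × (∀ π → IsMyopicGreedy I π → 𝔼Rev I π < c * opt)))
proposition4 c (ε , 0<ε , ε<c) with archimedean 0<ε
... | zero  , 1≤0 = contradiction
  (ℚₚ.<-≤-trans 0<1ℚ (subst (1ℚ ℚ.≤_) (ℚₚ.*-zeroʳ ε) 1≤0)) (ℚₚ.<-irrefl refl)
-- With `T = 4q` the optimum is `q` times `2 + 2T`, and `q ≥ 1` gives `T ≥ 4`, enough for the
-- optimality of product 0.
... | q@(suc q-1) , 1≤εq =
  greedyBelow-instance {c} {ε} {q} (q ℕ.* 4) 0<ε ε<c 1≤εq (ℕₚ.m≤m+n 3 (1 ℕ.+ q-1 ℕ.* 4)) (tri-q*4 q)
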